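{- Let $k\ge 1$ and $n\ge 3$ be integers and let $C_n$ be the cycle graph on $n$ vertices. If the vertices of $C_n$ are colored uniformly and independently with $k$ colors, the expected number of blocks is $$\mathbb{E}[X_k(C_n)] = \frac{1}{k^n}\left(k+n(k^n-k^{n-1})\right).$$
   Context: Given a coloring of the vertices of a finite graph $G$ with $k$ colors, the blocks are the connected components of the subgraph of $G$ formed by all vertices and all edges whose two endpoints have the same color. $X_k(G)$ denotes the number of blocks when each vertex of $G$ receives independently a uniformly random color among $k$ colors. -}

module Defs where

import Data.Bool.Properties as Bool
open import Data.Fin using (Fin; toℕ)
open import Data.Fin.Properties using () renaming (_≟_ to _≟ᶠ_)
open import Data.Fin.Subset using (Subset)
open import Data.Integer using (+_)
open import Data.List using (List; []; _∷_; allFin; cartesianProductWith; deduplicate; foldr; length; map)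
open import Data.List.Membership.Propositional using (_∈_)
open import Data.List.Membership.Propositional.Properties using (∈-allFin)
open import Data.List.Relation.Unary.Any using (here; there)
open import Data.Nat using (ℕ; zero; suc; _≤_; s≤s; NonZero)
open import Data.Nat.Properties using (1+n≢n) renaming (_≟_ to _≟ⁿ_)
open import Data.Product using (_×_; _,_)
open import Data.Rational using (ℚ; 0ℚ; 1ℚ; _+_; _*_; _/_)
open import Data.Sum using (_⊎_; inj₁; inj₂; [_,_]; swap)
open import Data.Vec as Vec using (Vec; lookup; tabulate)
open import Data.Vec.Properties using (≡-dec)
open import Relation.Binary using (Rel; Decidable; Symmetric; Irreflexive)
open import Relation.Binary.Construct.Closure.ReflexiveTransitive using (Star; ε; _◅_; _◅◅_)
open import Relation.Binary.PropositionalEquality using (_≡_; refl; sym)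
open import Relation.Nullary using (¬_; does)
open import Relation.Nullary.Decidable using (_×-dec_; _⊎-dec_; map′)
open import Level using (0ℓ)

record Graph (n : ℕ) : Set₁ where
  field
    Adj    : Rel (Fin n) 0ℓ
    adj?   : Decidable Adj
    symm   : Symmetric Adj
    irrefl : Irreflexive _≡_ Adj

open Graph public

Connected : ∀ {n} → Graph n → Rel (Fin n) 0ℓ
Connected G = Star (Adj G)

-- Connectedness is decided by Floyd–Warshall: Via zs x y says that y is
-- reached from x by a walk all of whose interior vertices lie in zs.
module _ {n} (G : Graph n) where

  Via : List (Fin n) → Rel (Fin n) 0ℓ
  Via []       x y = x ≡ y ⊎ Adj G x y
  Via (z ∷ zs) x y = Via zs x y ⊎ (Via zs x z × Via zs z y)

  via? : ∀ zs → Decidable (Via zs)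
  via? []       x y = (x ≟ᶠ y) ⊎-dec adj? G x y
  via? (z ∷ zs) x y = via? zs x y ⊎-dec (via? zs x z ×-dec via? zs z y)

  via-base : ∀ zs {x y} → Via [] x y → Via zs x y
  via-base []       p = p
  via-base (z ∷ zs) p = inj₁ (via-base zs p)

  via-trans : ∀ {zs x y z} → z ∈ zs → Via zs x z → Via zs z y → Via zs x y
  via-trans (here refl) p q =
    inj₂ ([ (λ a → a) , (λ (a , _) → a) ] p , [ (λ b → b) , (λ (_ , b) → b) ] q)
  via-trans (there i) (inj₁ p)       (inj₁ q)       = inj₁ (via-trans i p q)
  via-trans (there i) (inj₁ p)       (inj₂ (q , r)) = inj₂ (via-trans i p q , r)
  via-trans (there i) (inj₂ (p , q)) (inj₁ r)       = inj₂ (p , via-trans i q r)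
  via-trans (there i) (inj₂ (p , _)) (inj₂ (_ , r)) = inj₂ (p , r)

  via⇒connected : ∀ zs {x y} → Via zs x y → Connected G x y
  via⇒connected []       (inj₁ refl)    = ε
  via⇒connected []       (inj₂ a)       = a ◅ ε
  via⇒connected (z ∷ zs) (inj₁ p)       = via⇒connected zs p
  via⇒connected (z ∷ zs) (inj₂ (p , q)) = via⇒connected zs p ◅◅ via⇒connected zs q

  connected⇒via : ∀ {x y} → Connected G x y → Via (allFin n) x y
  connected⇒via ε       = via-base (allFin n) (inj₁ refl)
  connected⇒via (a ◅ p) =
    via-trans (∈-allFin _) (via-base (allFin n) (inj₂ a)) (connected⇒via p)

  connected? : Decidable (Connected G)
  connected? x y =
    map′ (via⇒connected (allFin n)) connected⇒via (via? (allFin n) x y)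

-- A connected component is represented by its vertex set.
component : ∀ {n} → Graph n → Fin n → Subset n
component G v = tabulate (λ u → does (connected? G v u))

components : ∀ {n} → Graph n → List (Subset n)
components {n} G = deduplicate (≡-dec Bool._≟_) (map (component G) (allFin n))

Coloring : ℕ → ℕ → Set
Coloring k n = Vec (Fin k) n

monochromatic : ∀ {k n} → Graph n → Coloring k n → Graph n
monochromatic G c = record
  { Adj    = λ u v → Adj G u v × lookup c u ≡ lookup c v
  ; adj?   = λ u v → adj? G u v ×-dec (lookup c u ≟ᶠ lookup c v)
  ; symm   = λ (a , e) → symm G a , sym e
  ; irrefl = λ e (a , _) → irrefl G e a
  }

blocks : ∀ {k n} → Graph n → Coloring k n → List (Subset n)
blocks G c = components (monochromatic G c)

X : ∀ {k n} → Graph n → Coloring k n → ℕ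
X G c = length (blocks G c)

colorings : ∀ k n → List (Coloring k n)
colorings k zero    = Vec.[] ∷ []
colorings k (suc n) = cartesianProductWith Vec._∷_ (allFin k) (colorings k n)

uniform : ∀ {k} .{{_ : NonZero k}} → Fin k → ℚ
uniform {k} _ = + 1 / k

-- Product measure: the vertex colors are independent, each uniform on Fin k.
probability : ∀ {k n} .{{_ : NonZero k}} → Coloring k n → ℚ
probability c = Vec.foldr _ _*_ 1ℚ (Vec.map uniform c)

𝔼 : ∀ {k n} .{{_ : NonZero k}} → (Coloring k n → ℕ) → ℚ
𝔼 {k} {n} Y = foldr _+_ 0ℚ (map (λ c → probability c * (+ Y c / 1)) (colorings k n))

-- j is the cyclic successor of i, i.e. j = i + 1 mod n.
Next : ∀ {n} → Rel (Fin n) 0ℓ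
Next {n} i j = toℕ j ≡ suc (toℕ i) ⊎ (suc (toℕ i) ≡ n × toℕ j ≡ 0)

next? : ∀ {n} → Decidable (Next {n})
next? {n} i j =
  (toℕ j ≟ⁿ suc (toℕ i)) ⊎-dec ((suc (toℕ i) ≟ⁿ n) ×-dec (toℕ j ≟ⁿ 0))

next-irrefl : ∀ {n} → 3 ≤ n → (i : Fin n) → ¬ Next i i
next-irrefl _         i (inj₁ e)       = 1+n≢n (sym e)
next-irrefl (s≤s n≥2) i (inj₂ (e , z)) rewrite z with e | n≥2
... | refl | ()

cycle : ∀ n → 3 ≤ n → Graph n
cycle n n≥3 = record
  { Adj    = λ i j → Next i j ⊎ Next j i
  ; adj?   = λ i j → next? i j ⊎-dec next? j i
  ; symm   = swap
  ; irrefl = λ { {i} refl → [ next-irrefl n≥3 i , next-irrefl n≥3 i ] }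
  }

{-# OPTIONS --safe #-}

-- Walk once around the cycle and let d be the number of color changes
-- between consecutive vertices. Label a vertex by the number of changes seen
-- before it, with the labels 0 and d identified. Two vertices lie in the same
-- block exactly when their labels agree, so there are d blocks, or a single
-- one when d = 0. Each of the n edges is a change in k^n - k^(n-1) colorings,
-- and d = 0 for the k constant colorings.
module Submission where

open import Data.Bool using (true; if_then_else_)
import Data.Bool.Properties as Bool
open import Data.Fin using (Fin; zero; suc; toℕ; fromℕ<)
open import Data.Fin.Properties using (toℕ<n; toℕ-fromℕ<; toℕ-injective) renaming (_≟_ to _≟ᶠ_)
open import Data.Integer using (+_; _⊖_) renaming (_+_ to _+ᶻ_; _*_ to _*ᶻ_; _-_ to _-ᶻ_)
import Data.Integer.Properties as ℤ
open import Data.List using (List; []; _∷_; _++_; allFin; cartesianProductWith; foldr; length; map)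
import Data.List as List
open import Data.List.Membership.Propositional using (_∈_)
open import Data.List.Membership.Propositional.Properties using (∈-allFin; ∈-deduplicate⁺; ∈-deduplicate⁻; ∈-map⁺; ∈-map⁻; ∈-tabulate⁺; ∈-tabulate⁻)
open import Data.List.Membership.Propositional.Properties.WithK using (unique∧set⇒bag)
open import Data.List.Properties using (length-tabulate; map-++; map-∘; map-cong; map-tabulate)
open import Data.List.Relation.Binary.BagAndSetEquality using (∼bag⇒↭)
open import Data.List.Relation.Binary.Permutation.Propositional.Properties using (↭-length)
import Data.List.Relation.Unary.Unique.DecPropositional.Properties as DecUnique
open import Data.List.Relation.Unary.Unique.Propositional using (Unique)
import Data.List.Relation.Unary.Unique.Propositional.Properties as Unique
open import Data.Nat using (ℕ; zero; suc; _≤_; _<_; z≤n; s≤s; _∸_; _^_; NonZero)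
import Data.Nat as ℕ
open import Data.Nat.ListAction using (sum)
open import Data.Nat.ListAction.Properties using (sum-++)
open import Data.Nat.Properties using (m^n≢0)
import Data.Nat.Properties as ℕ
open import Data.Nat.Tactic.RingSolver using (solve-∀)
open import Data.Product using (∃; _×_; _,_; proj₁; proj₂)
open import Data.Rational using (ℚ; 0ℚ; _*_; _/_; fromℚᵘ)
import Data.Rational as ℚ
import Data.Rational.Properties as ℚ
open import Data.Rational.Unnormalised using (mkℚᵘ)
import Data.Rational.Unnormalised as ℚᵘ
import Data.Rational.Unnormalised.Properties as ℚᵘ
open import Data.Sum using (_⊎_; inj₁; inj₂)
open import Data.Vec using (Vec; []; _∷_; lookup)
open import Data.Vec.Properties using (≡-dec; lookup∘tabulate; tabulate-cong)
open import Function using (_∘_; mk⇔)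
open import Relation.Binary.Construct.Closure.ReflexiveTransitive using (ε; _◅_; _◅◅_; reverse)
open import Relation.Binary.PropositionalEquality using (_≡_; _≢_; refl; sym; trans; cong; cong₂; subst; module ≡-Reasoning)
open import Relation.Nullary using (Dec; yes; no; does; contradiction)
open import Relation.Nullary.Decidable using (dec-true; does-⇔)
open import Defs

open ≡-Reasoning

-- Counting components

unique-length : ∀ {A : Set} {xs ys : List A} → Unique xs → Unique ys →
  (∀ {x} → x ∈ xs → x ∈ ys) → (∀ {x} → x ∈ ys → x ∈ xs) → length xs ≡ length ys
unique-length xs! ys! xs⊆ys ys⊆xs =
  ↭-length (∼bag⇒↭ (unique∧set⇒bag xs! ys! (mk⇔ xs⊆ys ys⊆xs)))

module _ {n} (G : Graph n) where

  connected-sym : ∀ {u v} → Connected G u v → Connected G v u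
  connected-sym = reverse (symm G)

  connected⇒component≡ : ∀ {u v} → Connected G u v → component G u ≡ component G v
  connected⇒component≡ {u} {v} p = tabulate-cong λ w →
    does-⇔ (mk⇔ (connected-sym p ◅◅_) (p ◅◅_)) (connected? G u w) (connected? G v w)

  -- Since `v` lies in its own component, equality of the vertex sets puts it in the component of
  -- `u` as well.
  component≡⇒connected : ∀ {u v} → component G u ≡ component G v → Connected G u v
  component≡⇒connected {u} {v} e = true⇒ (connected? G u v) (begin
    does (connected? G u v)    ≡⟨ lookup∘tabulate (λ w → does (connected? G u w)) v ⟨
    lookup (component G u) v   ≡⟨ cong (λ s → lookup s v) e ⟩
    lookup (component G v) v   ≡⟨ lookup∘tabulate (λ w → does (connected? G v w)) v ⟩
    does (connected? G v v)    ≡⟨ dec-true (connected? G v v) ε ⟩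
    true                       ∎)
    where
    true⇒ : ∀ {P : Set} (P? : Dec P) → does P? ≡ true → P
    true⇒ (yes p) _ = p

  -- Here `rep` is a transversal: by `separated` its components are pairwise distinct, and by
  -- `covering` every component occurs among them. Two duplicate-free lists with the same members
  -- have the same length.
  length-components : ∀ {N} (rep : Fin N → Fin n) →
    (∀ {i j} → Connected G (rep i) (rep j) → i ≡ j) →
    (∀ v → ∃ λ i → Connected G v (rep i)) →
    length (components G) ≡ N
  length-components {N} rep separated covering = trans
    (unique-length (DecUnique.deduplicate-! _≟_ _)
      (Unique.tabulate⁺ {f = component G ∘ rep} (separated ∘ component≡⇒connected))
      to from)
    (length-tabulate (component G ∘ rep))
    where
    _≟_ = ≡-dec Bool._≟_

    to : ∀ {S} → S ∈ components G → S ∈ List.tabulate (component G ∘ rep)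
    to S∈ with ∈-map⁻ (component G) (∈-deduplicate⁻ _≟_ (map (component G) (allFin n)) S∈)
    ... | v , _ , refl with covering v
    ...   | i , p rewrite connected⇒component≡ p = ∈-tabulate⁺ i

    from : ∀ {S} → S ∈ List.tabulate (component G ∘ rep) → S ∈ components G
    from S∈ with ∈-tabulate⁻ {f = component G ∘ rep} S∈
    ... | i , refl = ∈-deduplicate⁺ _≟_ (∈-map⁺ (component G) (∈-allFin (rep i)))

-- Color changes along a sequence

differ : ∀ {k} → Fin k → Fin k → ℕ
differ x y = if does (x ≟ᶠ y) then 0 else 1

-- Valued in `ℕ` so that it can be added to a number of changes and summed over colorings.
isZero : ℕ → ℕ
isZero zero    = 1
isZero (suc _) = 0

differ-≡ : ∀ {k} {x y : Fin k} → x ≡ y → differ x y ≡ 0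
differ-≡ {x = x} refl rewrite dec-true (x ≟ᶠ x) refl = refl

differ≡0 : ∀ {k} {x y : Fin k} → differ x y ≡ 0 → x ≡ y
differ≡0 {x = x} {y} e with x ≟ᶠ y
... | yes p = p

differ≤1 : ∀ {k} (x y : Fin k) → differ x y ≤ 1
differ≤1 x y with x ≟ᶠ y
... | yes _ = z≤n
... | no  _ = s≤s z≤n

changes : ∀ {k} → (ℕ → Fin k) → ℕ → ℕ
changes a zero    = 0
changes a (suc i) = changes a i ℕ.+ differ (a i) (a (suc i))

module _ {k} (a : ℕ → Fin k) where

  -- By definition `changes` splits off the last step. Colorings grow at the front, so inductions
  -- over them need the first step split off.
  changes-shift : ∀ i →
    changes a (suc i) ≡ differ (a 0) (a 1) ℕ.+ changes (a ∘ suc) i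
  changes-shift zero    = sym (ℕ.+-identityʳ _)
  changes-shift (suc i) = trans (cong (ℕ._+ differ (a (suc i)) (a (suc (suc i)))) (changes-shift i))
    (ℕ.+-assoc (differ (a 0) (a 1)) _ _)

  changes-mono : ∀ {i j} → i ≤ j → changes a i ≤ changes a j
  changes-mono {i} {zero}  z≤n = z≤n
  changes-mono {i} {suc j} i≤1+j with ℕ.m≤n⇒m<n∨m≡n i≤1+j
  ... | inj₁ (s≤s i≤j) = ℕ.≤-trans (changes-mono i≤j) (ℕ.m≤m+n _ _)
  ... | inj₂ refl      = ℕ.≤-refl

  changes-step : ∀ {i} → changes a (suc i) ≡ changes a i → a i ≡ a (suc i)
  changes-step {i} e = differ≡0 (ℕ.+-cancelˡ-≡ (changes a i) _ _ (trans e (sym (ℕ.+-identityʳ _))))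

  changes-≡ : ∀ {i} → a i ≡ a (suc i) → changes a (suc i) ≡ changes a i
  changes-≡ {i} e = trans (cong (changes a i ℕ.+_) (differ-≡ e)) (ℕ.+-identityʳ _)

  -- A discrete intermediate value theorem: the count starts at 0 and each step raises it by at most
  -- 1.
  changes-hits : ∀ i {t} → t ≤ changes a i → ∃ λ j → j ≤ i × changes a j ≡ t
  changes-hits zero    z≤n = 0 , z≤n , refl
  changes-hits (suc i) {t} t≤ with ℕ.≤-<-connex t (changes a i)
  ... | inj₁ t≤′ = let j , j≤i , e = changes-hits i t≤′ in j , ℕ.m≤n⇒m≤1+n j≤i , e
  ... | inj₂ <t  = suc i , ℕ.≤-refl , ℕ.≤-antisym
    (ℕ.≤-trans (ℕ.+-monoʳ-≤ (changes a i) (differ≤1 (a i) (a (suc i))))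
      (ℕ.≤-trans (ℕ.≤-reflexive (ℕ.+-comm (changes a i) 1)) <t))
    t≤

-- Blocks of a colored cycle

-- The default `z` extends the vector to a sequence on all of `ℕ`; its value at index `n` serves as
-- the end color of a path.
at : ∀ {A : Set} {n} → A → Vec A n → ℕ → A
at z []       _       = z
at z (x ∷ xs) zero    = x
at z (x ∷ xs) (suc i) = at z xs i

at-toℕ : ∀ {A : Set} {n} {z : A} (xs : Vec A n) i → at z xs (toℕ i) ≡ lookup xs i
at-toℕ (x ∷ xs) zero    = refl
at-toℕ (x ∷ xs) (suc i) = at-toℕ xs i

at-end : ∀ {A : Set} {n} {z : A} (xs : Vec A n) → at z xs n ≡ z
at-end []       = refl
at-end (x ∷ xs) = at-end xs

-- The path has end colors `x` and `z` and interior colors `xs`, hence `suc m` edges; the last one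
-- reaches the default value `z`.
pathChanges : ∀ {k m} → Fin k → Vec (Fin k) m → Fin k → ℕ
pathChanges {m = m} x xs z = changes (at z (x ∷ xs)) (suc m)

module _ {k m} (n≥3 : 3 ≤ suc m) (x : Fin k) (xs : Vec (Fin k) m) where

  private
    n = suc m

    -- Continuing by the first color makes the edge from n - 1 to 0 the step
    -- from index n - 1 to index n.
    a : ℕ → Fin k
    a = at x (x ∷ xs)

    G : Graph n
    G = monochromatic (cycle n n≥3) (x ∷ xs)

    L : Fin n → ℕ
    L v = changes a (toℕ v)

    -- `N` is the claimed number of blocks; `isZero d` supplies the single block of a constant
    -- coloring.
    d N : ℕ
    d = pathChanges x xs x
    N = d ℕ.+ isZero d

    L≤d : ∀ v → L v ≤ d
    L≤d v = changes-mono a (ℕ.<⇒≤ (toℕ<n v))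

    label : Fin n → ℕ
    label v = if does (L v ℕ.≟ d) then 0 else L v

    label-cases : ∀ v → (L v ≡ d × label v ≡ 0) ⊎ (L v ≢ d × label v ≡ L v)
    label-cases v = cases (L v ℕ.≟ d)
      where
      cases : (D : Dec (L v ≡ d)) →
        let l = if does D then 0 else L v in (L v ≡ d × l ≡ 0) ⊎ (L v ≢ d × l ≡ L v)
      cases (yes e) = inj₁ (e , refl)
      cases (no ne) = inj₂ (ne , refl)

    label-d : ∀ v → L v ≡ d → label v ≡ 0
    label-d v e with label-cases v
    ... | inj₁ (_ , l)  = l
    ... | inj₂ (ne , _) = contradiction e ne

    label-≢d : ∀ v → L v ≢ d → label v ≡ L v
    label-≢d v ne with label-cases v
    ... | inj₁ (e , _) = contradiction e ne
    ... | inj₂ (_ , l) = l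

    label-0 : ∀ v → L v ≡ 0 → label v ≡ 0
    label-0 v e with label-cases v
    ... | inj₁ (_ , l) = l
    ... | inj₂ (_ , l) = trans l e

    label-cong : ∀ u v → L u ≡ L v → label u ≡ label v
    label-cong u v e rewrite e = refl

    d≤N : d ≤ N
    d≤N = ℕ.m≤m+n d (isZero d)

    0<N : 0 < N
    0<N = positive d
      where
      positive : ∀ d → 0 < d ℕ.+ isZero d
      positive zero    = s≤s z≤n
      positive (suc d) = s≤s z≤n

    -- `N` is 1 if `d` is 0, and is `d` itself otherwise.
    <N⇒ : ∀ {t} → t < N → t ≡ 0 ⊎ t < d
    <N⇒ = cases d
      where
      cases : ∀ d {t} → t < d ℕ.+ isZero d → t ≡ 0 ⊎ t < d
      cases zero    (s≤s z≤n) = inj₁ refl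
      cases (suc d) {t} t<    = inj₂ (subst (t <_) (ℕ.+-identityʳ (suc d)) t<)

    label<N : ∀ v → label v < N
    label<N v with label-cases v
    ... | inj₁ (_ , l)  = subst (_< N) (sym l) 0<N
    ... | inj₂ (ne , l) = subst (_< N) (sym l) (ℕ.<-≤-trans (ℕ.≤∧≢⇒< (L≤d v) ne) d≤N)

    next-label : ∀ {u v} → Next u v → lookup (x ∷ xs) u ≡ lookup (x ∷ xs) v → label u ≡ label v
    next-label {u} {v} (inj₁ e) c = label-cong u v (sym (begin
      changes a (toℕ v)        ≡⟨ cong (changes a) e ⟩
      changes a (suc (toℕ u))  ≡⟨ changes-≡ a (begin
        a (toℕ u)                ≡⟨ at-toℕ (x ∷ xs) u ⟩
        lookup (x ∷ xs) u        ≡⟨ c ⟩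
        lookup (x ∷ xs) v        ≡⟨ at-toℕ (x ∷ xs) v ⟨
        a (toℕ v)                ≡⟨ cong a e ⟩
        a (suc (toℕ u))          ∎) ⟩
      changes a (toℕ u)        ∎))
    -- The closing edge: as it is no change, all `d` changes precede the last vertex, and the count
    -- `d` is relabeled 0, the label of vertex 0.
    next-label {u} {v} (inj₂ (last , first)) c =
      trans (label-d u (begin
        changes a (toℕ u)        ≡⟨ changes-≡ a (begin
          a (toℕ u)                ≡⟨ at-toℕ (x ∷ xs) u ⟩
          lookup (x ∷ xs) u        ≡⟨ c ⟩
          lookup (x ∷ xs) v        ≡⟨ at-toℕ (x ∷ xs) v ⟨
          a (toℕ v)                ≡⟨ cong a first ⟩
          x                        ≡⟨ at-end (x ∷ xs) ⟨
          a n                      ≡⟨ cong a last ⟨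
          a (suc (toℕ u))          ∎) ⟨
        changes a (suc (toℕ u))  ≡⟨ cong (changes a) last ⟩
        d                        ∎))
      (sym (label-0 v (cong (changes a) first)))

    connected⇒label≡ : ∀ {u v} → Connected G u v → label u ≡ label v
    connected⇒label≡ ε = refl
    connected⇒label≡ ((inj₁ e , c) ◅ p) = trans (next-label e c) (connected⇒label≡ p)
    connected⇒label≡ ((inj₂ e , c) ◅ p) = trans (sym (next-label e (sym c))) (connected⇒label≡ p)

    ≡⇒connected : ∀ {u v : Fin n} → toℕ u ≡ toℕ v → Connected G u v
    ≡⇒connected e with refl ← toℕ-injective e = ε

    -- Equal counts leave no change between `u` and `v`, so the walk along increasing indices stays
    -- in one color. The induction on the index `j` of `v` peels off the last step.
    forward : ∀ j u v → toℕ v ≡ j → toℕ u ≤ j → L u ≡ L v → Connected G u v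
    forward j u v v≡ u≤ e with ℕ.m≤n⇒m<n∨m≡n u≤
    ... | inj₂ u≡ = ≡⇒connected (trans u≡ (sym v≡))
    forward (suc j) u v v≡ _ e | inj₁ (s≤s u≤j) =
      forward j u w w≡ u≤j (trans (sym Lj≡) (cong (changes a) (sym w≡)))
        ◅◅ (inj₁ (inj₁ (trans v≡ (cong suc (sym w≡)))) , same) ◅ ε
      where
      j<n : j < n
      j<n = ℕ.<-trans (ℕ.n<1+n j) (subst (_< n) v≡ (toℕ<n v))
      w : Fin n
      w = fromℕ< j<n
      w≡ : toℕ w ≡ j
      w≡ = toℕ-fromℕ< j<n
      Lv≡ : L u ≡ changes a (suc j)
      Lv≡ = trans e (cong (changes a) v≡)
      -- By monotonicity the count at `j` is squeezed between those at `u` and at `suc j`, which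
      -- agree.
      Lj≡ : changes a j ≡ L u
      Lj≡ = ℕ.≤-antisym (ℕ.≤-trans (changes-mono a (ℕ.n≤1+n j)) (ℕ.≤-reflexive (sym Lv≡)))
                        (changes-mono a u≤j)
      same : lookup (x ∷ xs) w ≡ lookup (x ∷ xs) v
      same = begin
        lookup (x ∷ xs) w  ≡⟨ at-toℕ (x ∷ xs) w ⟨
        a (toℕ w)          ≡⟨ cong a w≡ ⟩
        a j                ≡⟨ changes-step a (sym (trans Lj≡ Lv≡)) ⟩
        a (suc j)          ≡⟨ cong a v≡ ⟨
        a (toℕ v)          ≡⟨ at-toℕ (x ∷ xs) v ⟩
        lookup (x ∷ xs) v  ∎

    L≡⇒connected : ∀ u v → L u ≡ L v → Connected G u v
    L≡⇒connected u v e with ℕ.≤-total (toℕ u) (toℕ v)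
    ... | inj₁ u≤v = forward _ u v refl u≤v e
    ... | inj₂ v≤u = connected-sym G (forward _ v u refl v≤u (sym e))

    -- Once all `d` changes have been seen, the color stays fixed up to the last vertex `w` and
    -- across the closing edge to vertex 0.
    d⇒connected-0 : ∀ u → L u ≡ d → Connected G u zero
    d⇒connected-0 u e =
      L≡⇒connected u w (trans e (sym Lw≡d)) ◅◅ (inj₁ (inj₂ (cong suc w≡ , refl)) , same) ◅ ε
      where
      w : Fin n
      w = fromℕ< (ℕ.n<1+n m)
      w≡ : toℕ w ≡ m
      w≡ = toℕ-fromℕ< (ℕ.n<1+n m)
      Lw≡d : L w ≡ d
      Lw≡d = ℕ.≤-antisym (L≤d w) (subst (_≤ L w) e
        (changes-mono a (subst (toℕ u ≤_) (sym w≡) (ℕ.≤-pred (toℕ<n u)))))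
      same : lookup (x ∷ xs) w ≡ x
      same = begin
        lookup (x ∷ xs) w  ≡⟨ at-toℕ (x ∷ xs) w ⟨
        a (toℕ w)          ≡⟨ cong a w≡ ⟩
        a m                ≡⟨ changes-step a (trans (sym Lw≡d) (cong (changes a) w≡)) ⟩
        a n                ≡⟨ at-end (x ∷ xs) ⟩
        x                  ∎

    label≡⇒connected : ∀ u v → label u ≡ label v → Connected G u v
    label≡⇒connected u v e with label-cases u | label-cases v
    ... | inj₁ (p , _) | inj₁ (q , _) = d⇒connected-0 u p ◅◅ connected-sym G (d⇒connected-0 v q)
    -- The common label is 0, so `v` has count 0, the count of vertex 0; the two walks meet there.
    ... | inj₁ (p , l) | inj₂ (_ , l′) =
      d⇒connected-0 u p ◅◅ L≡⇒connected zero v (trans (sym l) (trans e l′))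
    ... | inj₂ (_ , l) | inj₁ (q , l′) =
      L≡⇒connected u zero (trans (sym l) (trans e l′)) ◅◅ connected-sym G (d⇒connected-0 v q)
    ... | inj₂ (_ , l) | inj₂ (_ , l′) = L≡⇒connected u v (trans (sym l) (trans e l′))

    label-hits : ∀ {t} → t < N → ∃ λ v → label v ≡ t
    label-hits t<N with <N⇒ t<N
    ... | inj₁ refl = zero , label-0 zero refl
    ... | inj₂ t<d with changes-hits a n (ℕ.<⇒≤ t<d)
    ...   | j , j≤n , e = v , trans (label-≢d v (ℕ.<⇒≢ (subst (_< d) (sym Lv≡) t<d))) Lv≡
      where
      -- Index `n` is not a vertex, but its count is `d`, so a count below `d` is attained earlier.
      j<n : j < n
      j<n = ℕ.≤∧≢⇒< j≤n λ { refl → ℕ.<⇒≢ t<d (sym e) }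
      v : Fin n
      v = fromℕ< j<n
      Lv≡ : L v ≡ _
      Lv≡ = trans (cong (changes a) (toℕ-fromℕ< j<n)) e

  -- Connectedness in `G` is equality of labels and every label below `N` is attained, so choosing
  -- one vertex per label gives a transversal of the blocks.
  X-cycle : X (cycle (suc m) n≥3) (x ∷ xs) ≡ pathChanges x xs x ℕ.+ isZero (pathChanges x xs x)
  X-cycle = length-components G (λ i → proj₁ (label-hits (toℕ<n i)))
    (λ {i} {j} p → toℕ-injective (begin
      toℕ i   ≡⟨ proj₂ (label-hits (toℕ<n i)) ⟨
      _       ≡⟨ connected⇒label≡ p ⟩
      _       ≡⟨ proj₂ (label-hits (toℕ<n j)) ⟩
      toℕ j   ∎))
    (λ v → fromℕ< (label<N v) , label≡⇒connected v _ (begin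
      label v                    ≡⟨ toℕ-fromℕ< (label<N v) ⟨
      toℕ (fromℕ< (label<N v))   ≡⟨ proj₂ (label-hits (toℕ<n (fromℕ< (label<N v)))) ⟨
      _                          ∎))

-- Sums over colorings

module _ {A : Set} where

  ∑ : List A → (A → ℕ) → ℕ
  ∑ xs f = sum (map f xs)

  ∑-cong : ∀ {f g : A → ℕ} xs → (∀ x → f x ≡ g x) → ∑ xs f ≡ ∑ xs g
  ∑-cong xs f≗g = cong sum (map-cong f≗g xs)

  ∑-+ : ∀ (f g : A → ℕ) xs → ∑ xs (λ x → f x ℕ.+ g x) ≡ ∑ xs f ℕ.+ ∑ xs g
  ∑-+ f g []       = refl
  ∑-+ f g (x ∷ xs) = trans (cong (f x ℕ.+ g x ℕ.+_) (∑-+ f g xs))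
    (interchange (f x) (g x) (∑ xs f) (∑ xs g))
    where
    interchange : ∀ p q r s → p ℕ.+ q ℕ.+ (r ℕ.+ s) ≡ p ℕ.+ r ℕ.+ (q ℕ.+ s)
    interchange = solve-∀

  ∑-*ˡ : ∀ t (f : A → ℕ) xs → ∑ xs (λ x → t ℕ.* f x) ≡ t ℕ.* ∑ xs f
  ∑-*ˡ t f []       = sym (ℕ.*-zeroʳ t)
  ∑-*ˡ t f (x ∷ xs) = trans (cong (t ℕ.* f x ℕ.+_) (∑-*ˡ t f xs)) (sym (ℕ.*-distribˡ-+ t (f x) (∑ xs f)))

  ∑-const : ∀ t (xs : List A) → ∑ xs (λ _ → t) ≡ length xs ℕ.* t
  ∑-const t []       = refl
  ∑-const t (x ∷ xs) = cong (t ℕ.+_) (∑-const t xs)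

∑-cartesianProductWith : ∀ {A B C : Set} (h : A → B → C) (f : C → ℕ) xs ys →
  ∑ (cartesianProductWith h xs ys) f ≡ ∑ xs (λ x → ∑ ys (λ y → f (h x y)))
∑-cartesianProductWith h f []       ys = refl
∑-cartesianProductWith h f (x ∷ xs) ys = begin
  sum (map f (map (h x) ys ++ cartesianProductWith h xs ys))
    ≡⟨ cong sum (map-++ f (map (h x) ys) _) ⟩
  sum (map f (map (h x) ys) ++ map f (cartesianProductWith h xs ys))
    ≡⟨ sum-++ (map f (map (h x) ys)) _ ⟩
  ∑ (map (h x) ys) f ℕ.+ ∑ (cartesianProductWith h xs ys) f
    ≡⟨ cong₂ ℕ._+_ (cong sum (sym (map-∘ ys))) (∑-cartesianProductWith h f xs ys) ⟩
  ∑ (x ∷ xs) (λ x → ∑ ys (λ y → f (h x y))) ∎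

∑-colorings : ∀ k n (f : Coloring k (suc n) → ℕ) →
  ∑ (colorings k (suc n)) f ≡ ∑ (allFin k) (λ x → ∑ (colorings k n) (λ c → f (x ∷ c)))
∑-colorings k n f = ∑-cartesianProductWith _∷_ f (allFin k) (colorings k n)

∑-allFin-const : ∀ k t → ∑ (allFin k) (λ _ → t) ≡ k ℕ.* t
∑-allFin-const k t = trans (∑-const t (allFin k)) (cong (ℕ._* t) (length-tabulate {n = k} _))

∑-colorings-const : ∀ k n t → ∑ (colorings k n) (λ _ → t) ≡ k ^ n ℕ.* t
∑-colorings-const k zero    t = refl
∑-colorings-const k (suc n) t = begin
  ∑ (colorings k (suc n)) (λ _ → t)                        ≡⟨ ∑-colorings k n (λ _ → t) ⟩
  ∑ (allFin k) (λ _ → ∑ (colorings k n) (λ _ → t))         ≡⟨ ∑-cong (allFin k) (λ _ → ∑-colorings-const k n t) ⟩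
  ∑ (allFin k) (λ _ → k ^ n ℕ.* t)                         ≡⟨ ∑-allFin-const k _ ⟩
  k ℕ.* (k ^ n ℕ.* t)                                      ≡⟨ ℕ.*-assoc k (k ^ n) t ⟨
  k ^ suc n ℕ.* t                                          ∎

-- Sums over a single color

∑-allFin-suc : ∀ {k} (f : Fin (suc k) → ℕ) →
  ∑ (allFin (suc k)) f ≡ f zero ℕ.+ ∑ (allFin k) (f ∘ suc)
∑-allFin-suc f = cong (λ l → f zero ℕ.+ sum l) (trans (map-tabulate suc f) (sym (map-tabulate _ (f ∘ suc))))

differ-suc : ∀ {k} (x y : Fin k) → differ (suc x) (suc y) ≡ differ x y
differ-suc x y with x ≟ᶠ y
... | yes _ = refl
... | no _  = refl

∑-differ : ∀ {k} (x : Fin (suc k)) → ∑ (allFin (suc k)) (differ x) ≡ k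
∑-differ {k} zero = begin
  ∑ (allFin (suc k)) (differ zero)  ≡⟨ ∑-allFin-suc {k} (differ zero) ⟩
  ∑ (allFin k) (λ _ → 1)            ≡⟨ ∑-allFin-const k 1 ⟩
  k ℕ.* 1                           ≡⟨ ℕ.*-identityʳ k ⟩
  k                                 ∎
∑-differ {suc k} (suc x) = trans (∑-allFin-suc (differ (suc x)))
  (cong suc (trans (∑-cong (allFin (suc k)) (differ-suc x)) (∑-differ x)))

-- `isZero (differ x y)` is the Kronecker delta of `x` and `y`.
∑-isZero-differ : ∀ {k} (x : Fin k) (f : Fin k → ℕ) →
  ∑ (allFin k) (λ y → isZero (differ x y) ℕ.* f y) ≡ f x
∑-isZero-differ {suc k} zero f = begin
  ∑ (allFin (suc k)) (λ y → isZero (differ zero y) ℕ.* f y)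
    ≡⟨ ∑-allFin-suc (λ y → isZero (differ zero y) ℕ.* f y) ⟩
  f zero ℕ.+ 0 ℕ.+ ∑ (allFin k) (λ _ → 0)
    ≡⟨ cong₂ ℕ._+_ (ℕ.+-identityʳ (f zero)) (trans (∑-allFin-const k 0) (ℕ.*-zeroʳ k)) ⟩
  f zero ℕ.+ 0
    ≡⟨ ℕ.+-identityʳ (f zero) ⟩
  f zero ∎
∑-isZero-differ {suc k} (suc x) f = begin
  ∑ (allFin (suc k)) (λ y → isZero (differ (suc x) y) ℕ.* f y)
    ≡⟨ ∑-allFin-suc (λ y → isZero (differ (suc x) y) ℕ.* f y) ⟩
  ∑ (allFin k) (λ y → isZero (differ (suc x) (suc y)) ℕ.* f (suc y))
    ≡⟨ ∑-cong (allFin k) (λ y → cong (λ e → isZero e ℕ.* f (suc y)) (differ-suc x y)) ⟩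
  ∑ (allFin k) (λ y → isZero (differ x y) ℕ.* f (suc y))
    ≡⟨ ∑-isZero-differ x (f ∘ suc) ⟩
  f (suc x) ∎

-- Changes along a path, summed over its interior colors

isZero-+ : ∀ p q → isZero (p ℕ.+ q) ≡ isZero p ℕ.* isZero q
isZero-+ zero    q = sym (ℕ.+-identityʳ (isZero q))
isZero-+ (suc p) q = refl

pathChanges-∷ : ∀ {k m} (x y : Fin k) (c : Vec (Fin k) m) z →
  pathChanges x (y ∷ c) z ≡ differ x y ℕ.+ pathChanges y c z
pathChanges-∷ {m = m} x y c z = changes-shift (at z (x ∷ y ∷ c)) (suc m)

-- Only the interior coloring constantly `x` can avoid all changes, and it does so exactly when `z`
-- is `x` too. In the induction `isZero-+` factors the indicator along the first edge.
∑-isZero-pathChanges : ∀ {k} m (x z : Fin k) →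
  ∑ (colorings k m) (λ c → isZero (pathChanges x c z)) ≡ isZero (differ x z)
∑-isZero-pathChanges     zero    x z = ℕ.+-identityʳ _
∑-isZero-pathChanges {k} (suc m) x z = begin
  ∑ (colorings k (suc m)) (λ c → isZero (pathChanges x c z))
    ≡⟨ ∑-colorings k m (λ c → isZero (pathChanges x c z)) ⟩
  ∑ (allFin k) (λ y → ∑ (colorings k m) (λ c → isZero (pathChanges x (y ∷ c) z)))
    ≡⟨ ∑-cong (allFin k) first-step ⟩
  ∑ (allFin k) (λ y → isZero (differ x y) ℕ.* isZero (differ y z))
    ≡⟨ ∑-isZero-differ x (λ y → isZero (differ y z)) ⟩
  isZero (differ x z) ∎
  where
  first-step : ∀ y → ∑ (colorings k m) (λ c → isZero (pathChanges x (y ∷ c) z))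
                   ≡ isZero (differ x y) ℕ.* isZero (differ y z)
  first-step y = begin
    ∑ (colorings k m) (λ c → isZero (pathChanges x (y ∷ c) z))
      ≡⟨ ∑-cong (colorings k m) (λ c → trans (cong isZero (pathChanges-∷ x y c z)) (isZero-+ (differ x y) _)) ⟩
    ∑ (colorings k m) (λ c → isZero (differ x y) ℕ.* isZero (pathChanges y c z))
      ≡⟨ ∑-*ˡ (isZero (differ x y)) (λ c → isZero (pathChanges y c z)) (colorings k m) ⟩
    isZero (differ x y) ℕ.* ∑ (colorings k m) (λ c → isZero (pathChanges y c z))
      ≡⟨ cong (isZero (differ x y) ℕ.*_) (∑-isZero-pathChanges m y z) ⟩
    isZero (differ x y) ℕ.* isZero (differ y z) ∎

differ-comm : ∀ {k} (x y : Fin k) → differ x y ≡ differ y x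
differ-comm zero    zero    = refl
differ-comm zero    (suc y) = refl
differ-comm (suc x) zero    = refl
differ-comm (suc x) (suc y) = trans (differ-suc x y) (trans (differ-comm x y) (sym (differ-suc y x)))

module _ (k′ : ℕ) where

  private
    k = suc k′

  -- With the start color summed as well, each of the `suc m` edges is a change in `k′ * k ^ m`
  -- cases, `k′` being the number of colors other than a given one. The two lemmas are proved by
  -- mutual induction: removing the first edge of a path with fixed start leaves a shorter path
  -- whose start is free.
  ∑∑-pathChanges : ∀ m (z : Fin k) →
    ∑ (allFin k) (λ y → ∑ (colorings k m) (λ c → pathChanges y c z)) ≡ suc m ℕ.* (k′ ℕ.* k ^ m)

  -- Summed over the interior colors of a path with at least two edges,
  -- every edge has a free endpoint, so the end colors do not matter.
  ∑-pathChanges : ∀ m (x z : Fin k) →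
    ∑ (colorings k (suc m)) (λ c → pathChanges x c z) ≡ suc (suc m) ℕ.* (k′ ℕ.* k ^ m)

  ∑∑-pathChanges zero z = begin
    ∑ (allFin k) (λ y → differ y z ℕ.+ 0)  ≡⟨ ∑-cong (allFin k) (λ y → trans (ℕ.+-identityʳ _) (differ-comm y z)) ⟩
    ∑ (allFin k) (differ z)                ≡⟨ ∑-differ z ⟩
    k′                                     ≡⟨ identity k′ ⟩
    1 ℕ.* (k′ ℕ.* 1)                       ∎
    where
    identity : ∀ p → p ≡ 1 ℕ.* (p ℕ.* 1)
    identity = solve-∀
  ∑∑-pathChanges (suc m) z = begin
    ∑ (allFin k) (λ y → ∑ (colorings k (suc m)) (λ c → pathChanges y c z))
      ≡⟨ ∑-cong (allFin k) (λ y → ∑-pathChanges m y z) ⟩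
    ∑ (allFin k) (λ _ → suc (suc m) ℕ.* (k′ ℕ.* k ^ m))
      ≡⟨ ∑-allFin-const k _ ⟩
    k ℕ.* (suc (suc m) ℕ.* (k′ ℕ.* k ^ m))
      ≡⟨ rearrange k (suc (suc m)) k′ (k ^ m) ⟩
    suc (suc m) ℕ.* (k′ ℕ.* k ^ suc m) ∎
    where
    rearrange : ∀ p q r s → p ℕ.* (q ℕ.* (r ℕ.* s)) ≡ q ℕ.* (r ℕ.* (p ℕ.* s))
    rearrange = solve-∀

  ∑-pathChanges m x z = begin
    ∑ (colorings k (suc m)) (λ c → pathChanges x c z)
      ≡⟨ ∑-colorings k m (λ c → pathChanges x c z) ⟩
    ∑ (allFin k) (λ y → ∑ (colorings k m) (λ c → pathChanges x (y ∷ c) z))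
      ≡⟨ ∑-cong (allFin k) first-step ⟩
    ∑ (allFin k) (λ y → k ^ m ℕ.* differ x y ℕ.+ ∑ (colorings k m) (λ c → pathChanges y c z))
      ≡⟨ ∑-+ (λ y → k ^ m ℕ.* differ x y) _ (allFin k) ⟩
    ∑ (allFin k) (λ y → k ^ m ℕ.* differ x y)
      ℕ.+ ∑ (allFin k) (λ y → ∑ (colorings k m) (λ c → pathChanges y c z))
      ≡⟨ cong₂ ℕ._+_ (trans (∑-*ˡ (k ^ m) (differ x) (allFin k)) (cong (k ^ m ℕ.*_) (∑-differ x))) (∑∑-pathChanges m z) ⟩
    k ^ m ℕ.* k′ ℕ.+ suc m ℕ.* (k′ ℕ.* k ^ m)
      -- Multiplication by `suc (suc m)` unfolds to one summand plus the `suc m`-fold one, so only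
      -- the first summand needs its factors swapped.
      ≡⟨ cong (ℕ._+ suc m ℕ.* (k′ ℕ.* k ^ m)) (ℕ.*-comm (k ^ m) k′) ⟩
    suc (suc m) ℕ.* (k′ ℕ.* k ^ m) ∎
    where
    first-step : ∀ y → ∑ (colorings k m) (λ c → pathChanges x (y ∷ c) z)
                     ≡ k ^ m ℕ.* differ x y ℕ.+ ∑ (colorings k m) (λ c → pathChanges y c z)
    first-step y = begin
      ∑ (colorings k m) (λ c → pathChanges x (y ∷ c) z)
        ≡⟨ ∑-cong (colorings k m) (λ c → pathChanges-∷ x y c z) ⟩
      ∑ (colorings k m) (λ c → differ x y ℕ.+ pathChanges y c z)
        ≡⟨ ∑-+ (λ _ → differ x y) (λ c → pathChanges y c z) (colorings k m) ⟩
      ∑ (colorings k m) (λ _ → differ x y) ℕ.+ ∑ (colorings k m) (λ c → pathChanges y c z)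
        ≡⟨ cong (ℕ._+ ∑ (colorings k m) (λ c → pathChanges y c z)) (∑-colorings-const k m (differ x y)) ⟩
      k ^ m ℕ.* differ x y ℕ.+ ∑ (colorings k m) (λ c → pathChanges y c z) ∎

  -- Fixing the color `x` of vertex 0 cuts the cycle open into a path from `x` to `x`. Its changes
  -- have a total independent of `x`, and the constant coloring adds 1; then the `k` choices of `x`
  -- are summed.
  ∑-X-cycle : ∀ m (n≥3 : 3 ≤ suc (suc m)) →
    ∑ (colorings k (suc (suc m))) (X (cycle (suc (suc m)) n≥3))
      ≡ k ℕ.+ suc (suc m) ℕ.* (k′ ℕ.* k ^ suc m)
  ∑-X-cycle m n≥3 = begin
    ∑ (colorings k (suc (suc m))) (X (cycle (suc (suc m)) n≥3))
      ≡⟨ ∑-colorings k (suc m) (X (cycle (suc (suc m)) n≥3)) ⟩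
    ∑ (allFin k) (λ x → ∑ (colorings k (suc m)) (λ c → X (cycle (suc (suc m)) n≥3) (x ∷ c)))
      ≡⟨ ∑-cong (allFin k) fixed-first ⟩
    ∑ (allFin k) (λ _ → suc (suc m) ℕ.* (k′ ℕ.* k ^ m) ℕ.+ 1)
      ≡⟨ ∑-allFin-const k _ ⟩
    k ℕ.* (suc (suc m) ℕ.* (k′ ℕ.* k ^ m) ℕ.+ 1)
      ≡⟨ rearrange k (suc (suc m)) k′ (k ^ m) ⟩
    k ℕ.+ suc (suc m) ℕ.* (k′ ℕ.* k ^ suc m) ∎
    where
    rearrange : ∀ p q r s → p ℕ.* (q ℕ.* (r ℕ.* s) ℕ.+ 1) ≡ p ℕ.+ q ℕ.* (r ℕ.* (p ℕ.* s))
    rearrange = solve-∀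

    fixed-first : ∀ x → ∑ (colorings k (suc m)) (λ c → X (cycle (suc (suc m)) n≥3) (x ∷ c))
                      ≡ suc (suc m) ℕ.* (k′ ℕ.* k ^ m) ℕ.+ 1
    fixed-first x = begin
      ∑ (colorings k (suc m)) (λ c → X (cycle (suc (suc m)) n≥3) (x ∷ c))
        ≡⟨ ∑-cong (colorings k (suc m)) (X-cycle n≥3 x) ⟩
      ∑ (colorings k (suc m)) (λ c → pathChanges x c x ℕ.+ isZero (pathChanges x c x))
        ≡⟨ ∑-+ (λ c → pathChanges x c x) _ (colorings k (suc m)) ⟩
      ∑ (colorings k (suc m)) (λ c → pathChanges x c x)
        ℕ.+ ∑ (colorings k (suc m)) (λ c → isZero (pathChanges x c x))
        ≡⟨ cong₂ ℕ._+_ (∑-pathChanges m x x) (trans (∑-isZero-pathChanges (suc m) x x) (cong isZero (differ-≡ {x = x} refl))) ⟩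
      suc (suc m) ℕ.* (k′ ℕ.* k ^ m) ℕ.+ 1 ∎

-- Expectations

-- Normalized fractions are determined by their unnormalized values, where the identity is one of
-- equivalent fractions.
fromℚᵘ-homo-+ : ∀ p q → fromℚᵘ (p ℚᵘ.+ q) ≡ fromℚᵘ p ℚ.+ fromℚᵘ q
fromℚᵘ-homo-+ p q = ℚ.toℚᵘ-injective (ℚᵘ.≃-trans (ℚ.toℚᵘ-fromℚᵘ (p ℚᵘ.+ q))
  (ℚᵘ.≃-sym (ℚᵘ.≃-trans (ℚ.toℚᵘ-homo-+ (fromℚᵘ p) (fromℚᵘ q))
    (ℚᵘ.+-cong (ℚ.toℚᵘ-fromℚᵘ p) (ℚ.toℚᵘ-fromℚᵘ q)))))

fromℚᵘ-homo-* : ∀ p q → fromℚᵘ (p ℚᵘ.* q) ≡ fromℚᵘ p * fromℚᵘ q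
fromℚᵘ-homo-* p q = ℚ.toℚᵘ-injective (ℚᵘ.≃-trans (ℚ.toℚᵘ-fromℚᵘ (p ℚᵘ.* q))
  (ℚᵘ.≃-sym (ℚᵘ.≃-trans (ℚ.toℚᵘ-homo-* (fromℚᵘ p) (fromℚᵘ q))
    (ℚᵘ.*-cong (ℚ.toℚᵘ-fromℚᵘ p) (ℚ.toℚᵘ-fromℚᵘ q)))))

+/1-homo : ∀ a b → (+ (a ℕ.+ b)) / 1 ≡ (+ a / 1) ℚ.+ (+ b / 1)
+/1-homo a b = trans
  -- Unnormalized addition multiplies each numerator by the other denominator, here 1; these factors
  -- are inserted first.
  (cong (_/ 1) (trans (ℤ.pos-+ a b) (sym (cong₂ _+ᶻ_ (ℤ.*-identityʳ (+ a)) (ℤ.*-identityʳ (+ b))))))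
  (fromℚᵘ-homo-+ (mkℚᵘ (+ a) 0) (mkℚᵘ (+ b) 0))

1/-homo-* : ∀ a b .{{_ : NonZero a}} .{{_ : NonZero b}} .{{_ : NonZero (a ℕ.* b)}} →
  + 1 / (a ℕ.* b) ≡ (+ 1 / a) * (+ 1 / b)
1/-homo-* (suc a) (suc b) = fromℚᵘ-homo-* (mkℚᵘ (+ 1) a) (mkℚᵘ (+ 1) b)

probability-uniform : ∀ k n .{{_ : NonZero k}} (c : Coloring k n) →
  probability c ≡ _/_ (+ 1) (k ^ n) {{m^n≢0 k n}}
probability-uniform k zero    []      = refl
probability-uniform k (suc n) {{k≢0}} (x ∷ c) = trans (cong ((+ 1 / k) *_) (probability-uniform k n c))
  (sym (1/-homo-* k (k ^ n) {{k≢0}} {{m^n≢0 k n}} {{m^n≢0 k (suc n)}}))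

foldr-+-weighted : ∀ {A : Set} (p : A → ℚ) (q : ℚ) (f : A → ℕ) → (∀ x → p x ≡ q) → ∀ xs →
  foldr ℚ._+_ 0ℚ (map (λ x → p x * (+ f x / 1)) xs) ≡ q * (+ ∑ xs f / 1)
foldr-+-weighted p q f p≗q []       = sym (ℚ.*-zeroʳ q)
foldr-+-weighted p q f p≗q (x ∷ xs) = begin
  p x * (+ f x / 1) ℚ.+ foldr ℚ._+_ 0ℚ (map (λ x → p x * (+ f x / 1)) xs)
    ≡⟨ cong₂ ℚ._+_ (cong (_* (+ f x / 1)) (p≗q x)) (foldr-+-weighted p q f p≗q xs) ⟩
  q * (+ f x / 1) ℚ.+ q * (+ ∑ xs f / 1)
    ≡⟨ ℚ.*-distribˡ-+ q (+ f x / 1) (+ ∑ xs f / 1) ⟨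
  q * ((+ f x / 1) ℚ.+ (+ ∑ xs f / 1))
    ≡⟨ cong (q *_) (+/1-homo (f x) (∑ xs f)) ⟨
  q * (+ (f x ℕ.+ ∑ xs f) / 1) ∎

-- The total enters through an equation with an integer `t`, so that a formula containing integer
-- subtraction can be put in its place.
𝔼-uniform : ∀ k n .{{_ : NonZero k}} (Y : Coloring k n → ℕ) {t} → + ∑ (colorings k n) Y ≡ t →
  𝔼 Y ≡ _/_ (+ 1) (k ^ n) {{m^n≢0 k n}} * (t / 1)
𝔼-uniform k n Y refl = foldr-+-weighted probability _ Y (probability-uniform k n) (colorings k n)

-- `suc k * p` unfolds to `p + k * p`, so taking away `p` leaves exactly `k * p`, and the truncated
-- difference agrees with the integer one.
pos-*-∸ : ∀ k n p → + (suc k ℕ.+ n ℕ.* (k ℕ.* p)) ≡ + suc k +ᶻ + n *ᶻ (+ (suc k ℕ.* p) -ᶻ + p)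
pos-*-∸ k n p = begin
  + (suc k ℕ.+ n ℕ.* (k ℕ.* p))                 ≡⟨ ℤ.pos-+ (suc k) _ ⟩
  + suc k +ᶻ + (n ℕ.* (k ℕ.* p))                ≡⟨ cong (+ suc k +ᶻ_) (ℤ.pos-* n (k ℕ.* p)) ⟩
  + suc k +ᶻ + n *ᶻ + (k ℕ.* p)                 ≡⟨ cong (λ t → + suc k +ᶻ + n *ᶻ t) (begin
    + (k ℕ.* p)                                   ≡⟨ cong +_ (ℕ.m+n∸m≡n p (k ℕ.* p)) ⟨
    + (p ℕ.+ k ℕ.* p ∸ p)                         ≡⟨ ℤ.⊖-≥ (ℕ.m≤m+n p (k ℕ.* p)) ⟨
    (p ℕ.+ k ℕ.* p) ⊖ p                         ≡⟨ ℤ.m-n≡m⊖n (p ℕ.+ k ℕ.* p) p ⟨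
    + (suc k ℕ.* p) -ᶻ + p                        ∎) ⟩
  + suc k +ᶻ + n *ᶻ (+ (suc k ℕ.* p) -ᶻ + p)    ∎

corollary3p2 : (k n : ℕ) .{{_ : NonZero k}} (n≥3 : 3 ≤ n) →
    𝔼 {k} {n} (X (cycle n n≥3))
    ≡ _/_ (+ 1) (k ^ n) {{m^n≢0 k n}} * ((+ k +ᶻ + n *ᶻ (+ (k ^ n) -ᶻ + (k ^ (n ∸ 1)))) / 1)
corollary3p2 _       (suc zero)    (s≤s ())
corollary3p2 (suc k) (suc (suc m)) n≥3 = 𝔼-uniform (suc k) (suc (suc m)) (X (cycle (suc (suc m)) n≥3))
  -- With `p` equal to `suc k ^ suc m`, the product `suc k * p` is the power with exponent `n`, and
  -- `p` the one with exponent `n ∸ 1`.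
  (trans (cong +_ (∑-X-cycle k m n≥3)) (pos-*-∸ k (suc (suc m)) (suc k ^ suc m)))
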